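{- Let $n\ge 2$. For any $w\in\mathcal{M}_n$, $$l(w)=\rho(\mathbf{x}_w),\qquad\text{where } \mathbf{x}_w:=\lambda_B-w\lambda_B\in\{0,1\}^n .$$ In other words, for any $\mathbf{x}=(x_1,\dots,x_n)\in\{0,1\}^n$, $$\rho(\mathbf{x})=l\bigl(w_{\mathrm{supp}(\mathbf{x})}\bigr),\qquad\text{where } \mathrm{supp}(\mathbf{x})=\{i\mid x_i=1\}.$$
   Context: Let $\epsilon_1,\dots,\epsilon_n$ be the standard basis of $\mathbb{R}^n$ with the standard inner product $(\cdot,\cdot)$. Put $\alpha_1:=\epsilon_1$ and $\alpha_i:=\epsilon_i-\epsilon_{i-1}$ for $2\le i\le n$ (a simple system of type $B_n$). Let $s_i(v):=v-2\frac{(\alpha_i,v)}{(\alpha_i,\alpha_i)}\alpha_i$, and let $W(B_n)$ be the group generated by $s_1,\dots,s_n$. The length $l(w)$ of $w\in W(B_n)$ is the least $r$ such that $w$ is a product of $r$ of the generators $s_1,\dots,s_n$. Put $\lambda_B:=(1/2,\dots,1/2)\in\mathbb{R}^n$. For $J=\{j_1<j_2<\dots<j_t\}\subseteq\{1,\dots,n\}$ let $w_J:=w_{j_1}w_{j_2}\cdots w_{j_t}$ (composition of maps, rightmost applied first), where $w_j:=s_js_{j-1}\cdots s_1$, and $w_\emptyset:=\mathrm{id}$. Let $\mathcal{M}_n:=\{w_J\mid J\subseteq\{1,\dots,n\}\}$ (this is the set of $\lambda_B$-minuscule elements). The moment function is $\rho(x_1,\dots,x_n):=x_1+2x_2+\dots+nx_n$.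 -}

module Defs where

open import Level using (Level; _⊔_)
open import Algebra.Apartness.Bundles using (HeytingField; HeytingCommutativeRing)
open import Algebra.Bundles using (CommutativeRing)
import Algebra.Apartness.Properties.HeytingCommutativeRing as HCRProperties
import Algebra.Definitions.RawMonoid as RawMonoidDefs
import Algebra.Properties.Semiring.Sum as SemiringSum
import Algebra.Properties.Ring as RingProperties
open import Data.Bool.Base using (Bool; true; false)
open import Data.Empty using (⊥-elim)
open import Data.Fin.Base using (Fin; zero; suc; toℕ; inject₁)
open import Data.Fin.Subset using (Subset; _∈_)
open import Data.Fin.Subset.Properties using (_∈?_)
open import Data.List.Base using (List; []; _∷_; map; foldr; filter; allFin; length)
open import Data.Nat.Base using (ℕ; zero; suc; _≤_)
open import Data.Product.Base using (Σ; ∃; _×_; _,_; proj₁; proj₂)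
open import Data.Sum.Base using (_⊎_; inj₁; inj₂)
open import Data.Vec.Base using (tabulate)
open import Data.Vec.Properties using (lookup∘tabulate; lookup⇒[]=; []=⇒lookup)
open import Data.Vec.Functional using (Vector)
open import Function.Base using (id; _∘_)
open import Function.Bundles using (_⇔_; mk⇔)
open import Relation.Binary.PropositionalEquality.Core as ≡ using (_≡_)
open import Relation.Nullary.Negation using (¬_)

private
  variable
    c ℓ₁ ℓ₂ : Level
    n : ℕ

CharacteristicZero : HeytingField c ℓ₁ ℓ₂ → Set ℓ₂
CharacteristicZero F = ∀ k → (suc k · 1#) # 0#
  where
  open HeytingField F
  open HeytingCommutativeRing heytingCommutativeRing using (commutativeRing)
  open CommutativeRing commutativeRing using (+-rawMonoid)
  open RawMonoidDefs +-rawMonoid using () renaming (_×_ to _·_)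

-- The scalars form an arbitrary Heyting field of characteristic zero; the
-- real numbers are the intended instance.
module TypeB (F : HeytingField c ℓ₁ ℓ₂) (char0 : CharacteristicZero F) where

  open HeytingField F hiding (zero; Carrier; _≈_)
  open HeytingField F public using (Carrier; _≈_)
  open HeytingCommutativeRing heytingCommutativeRing using (commutativeRing)
  open CommutativeRing commutativeRing using (+-rawMonoid; semiring; ring)
  open RawMonoidDefs +-rawMonoid using (sum) renaming (_×_ to _·_) public
  open HCRProperties heytingCommutativeRing using (#-congʳ; x-0≈x; 1#0)

  -- #⇒invertible inverts the difference x - 0#.
  inverse : (x : Carrier) → x # 0# → Carrier
  inverse x x#0 = proj₁ (#⇒invertible x#0)

  fromℕ : ℕ → Carrier
  fromℕ k = k · 1#

  2# : Carrier
  2# = fromℕ 2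

  ½ : Carrier
  ½ = inverse 2# (char0 1)

  infix 4 _≈ᵛ_
  _≈ᵛ_ : Vector Carrier n → Vector Carrier n → Set ℓ₁
  u ≈ᵛ v = ∀ i → u i ≈ v i

  infixl 6 _-ᵛ_
  _-ᵛ_ : Vector Carrier n → Vector Carrier n → Vector Carrier n
  (u -ᵛ v) i = u i - v i

  infixr 7 _*ᵛ_
  _*ᵛ_ : Carrier → Vector Carrier n → Vector Carrier n
  (a *ᵛ v) i = a * v i

  ⟨_,_⟩ : Vector Carrier n → Vector Carrier n → Carrier
  ⟨ u , v ⟩ = sum (λ i → u i * v i)

  basis : Fin n → Vector Carrier n
  basis zero    zero    = 1#
  basis zero    (suc j) = 0#
  basis (suc i) zero    = 0#
  basis (suc i) (suc j) = basis i j

  -- Indices in Fin n start at 0, so α zero is α₁ = ε₁.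
  α : Fin n → Vector Carrier n
  α zero    = basis zero
  α (suc i) = basis (suc i) -ᵛ basis (inject₁ i)

  private
    module S = SemiringSum semiring
    module R = RingProperties ring

  sum-0 : (v : Vector Carrier n) → (∀ i → v i ≈ 0#) → sum v ≈ 0#
  sum-0 {n} v v≈0 = trans (S.sum-cong-≋ v≈0) (S.sum-replicate-zero n)

  0-0≈0 : 0# - 0# ≈ 0#
  0-0≈0 = -‿inverseʳ 0#

  1-0≈1 : 1# - 0# ≈ 1#
  1-0≈1 = x-0≈x 1#

  norm-zero : ⟨ α (zero {n}) , α zero ⟩ ≈ 1#
  norm-zero {n} = trans
    (+-cong (*-identityˡ 1#)
            (sum-0 {n} (λ i → basis (zero {n}) (suc i) * basis (zero {n}) (suc i))
                   (λ _ → zeroˡ 0#)))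
    (+-identityʳ 1#)

  0-1-squared : (0# - 1#) * (0# - 1#) ≈ 1#
  0-1-squared = trans (*-cong (+-identityˡ _) (+-identityˡ _))
    (trans (sym (R.-‿distribˡ-* 1# (- 1#)))
    (trans (-‿cong (*-identityˡ _)) (R.-‿involutive 1#)))

  norm-suc : ∀ {n} (i : Fin n) → ⟨ α (suc i) , α (suc i) ⟩ ≈ 2#
  norm-suc {suc n} zero = +-cong 0-1-squared
    (+-cong (trans (*-cong 1-0≈1 1-0≈1) (*-identityˡ 1#))
      (sum-0 {n} (λ i → (0# - 0#) * (0# - 0#))
        (λ _ → trans (*-congʳ 0-0≈0) (zeroˡ _))))
  norm-suc {suc n} (suc i) = trans
    (+-cong (trans (*-congʳ 0-0≈0) (zeroˡ _)) (norm-suc i))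
    (+-identityˡ 2#)

  norm-α#0 : (i : Fin n) → ⟨ α i , α i ⟩ # 0#
  norm-α#0 {suc n} zero    = #-congʳ (sym (norm-zero {n})) 1#0
  norm-α#0 {suc n} (suc i) = #-congʳ (sym (norm-suc i)) (char0 1)

  reflection : Fin n → Vector Carrier n → Vector Carrier n
  reflection i v =
    v -ᵛ (2# * (⟨ α i , v ⟩ * inverse ⟨ α i , α i ⟩ (norm-α#0 i))) *ᵛ α i

  data Generated {n} : (Vector Carrier n → Vector Carrier n) → Set (c ⊔ ℓ₁) where
    generator   : ∀ i → Generated (reflection i)
    identity    : Generated id
    composition : ∀ {f g} → Generated f → Generated g → Generated (f ∘ g)
    inverseOf   : ∀ {f g} → Generated f →
                  (∀ v → f (g v) ≈ᵛ v) → (∀ v → g (f v) ≈ᵛ v) → Generated g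

  W : ℕ → Set (c ⊔ ℓ₁)
  W n = Σ (Vector Carrier n → Vector Carrier n) Generated

  infixr 8 _⟨$⟩_
  _⟨$⟩_ : W n → Vector Carrier n → Vector Carrier n
  (f , _) ⟨$⟩ v = f v

  infix 4 _≈ʷ_
  _≈ʷ_ : W n → W n → Set (c ⊔ ℓ₁)
  w ≈ʷ w′ = ∀ v → w ⟨$⟩ v ≈ᵛ w′ ⟨$⟩ v

  s : Fin n → W n
  s i = reflection i , generator i

  product : List (W n) → W n
  product = foldr (λ (f , p) (g , q) → f ∘ g , composition p q) (id , identity)

  record HasLength (w : W n) (r : ℕ) : Set (c ⊔ ℓ₁) where
    field
      attained : ∃ λ (is : List (Fin n)) → length is ≡ r × product (map s is) ≈ʷ w
      least    : ∀ (is : List (Fin n)) → product (map s is) ≈ʷ w → r ≤ length is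

  descending : Fin n → List (Fin n)
  descending zero    = zero ∷ []
  descending (suc j) = suc j ∷ map inject₁ (descending j)

  wᵢ : Fin n → W n
  wᵢ j = product (map s (descending j))

  -- allFin lists Fin n in increasing order, hence so does its filtering by J.
  w[_] : Subset n → W n
  w[_] {n} J = product (map wᵢ (filter (_∈? J) (allFin n)))

  𝓜 : W n → Set (c ⊔ ℓ₁)
  𝓜 {n} w = ∃ λ (J : Subset n) → w ≈ʷ w[ J ]

  λB : Vector Carrier n
  λB _ = ½

  𝐱 : W n → Vector Carrier n
  𝐱 w = λB -ᵛ w ⟨$⟩ λB

  ρ : Vector Carrier n → Carrier
  ρ x = sum (λ i → suc (toℕ i) · x i)

  Binary : Vector Carrier n → Set ℓ₁
  Binary x = ∀ i → x i ≈ 0# ⊎ x i ≈ 1#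

  isOne : ∀ {a} → a ≈ 0# ⊎ a ≈ 1# → Bool
  isOne (inj₁ _) = false
  isOne (inj₂ _) = true

  supp : (x : Vector Carrier n) → Binary x → Subset n
  supp x x∈01 = tabulate (λ i → isOne (x∈01 i))

  ∈-supp : (x : Vector Carrier n) (x∈01 : Binary x) →
           ∀ i → i ∈ supp x x∈01 ⇔ x i ≈ 1#
  ∈-supp x x∈01 i = mk⇔
    (λ i∈ → to (x∈01 i) (≡.trans (≡.sym (lookup∘tabulate _ i)) ([]=⇒lookup i∈)))
    (λ xi≈1 → lookup⇒[]= i _ (≡.trans (lookup∘tabulate _ i) (from (x∈01 i) xi≈1)))
    where
    to : ∀ {a} (d : a ≈ 0# ⊎ a ≈ 1#) → isOne d ≡ true → a ≈ 1#
    to (inj₂ a≈1) _ = a≈1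
    from : ∀ {a} (d : a ≈ 0# ⊎ a ≈ 1#) → a ≈ 1# → isOne d ≡ true
    from (inj₁ a≈0) a≈1 = ⊥-elim (#-irrefl (trans (sym a≈1) a≈0) 1#0)
    from (inj₂ _)   _   = ≡.refl

{-# OPTIONS --safe #-}
module Submission where

-- The generators permute the vectors with entries ±½, and each of them changes
-- the moment of the set of negative coordinates by at most one: s₁ flips the
-- first sign and sᵢ swaps the coordinates i - 1 and i. Starting from λB, every
-- word for w is therefore at least as long as ρ(λB - w λB). The defining word
-- of w_J attains this bound: w_j moves the first coordinate to position j with
-- its sign flipped, so when applied in the order of decreasing j to λB, each
-- w_j merely negates coordinate j, at the cost of j generators.

open import Defs
open import Algebra.Apartness.Bundles using (HeytingField; HeytingCommutativeRing)
import Algebra.Apartness.Properties.HeytingCommutativeRing as HCRProperties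
open import Algebra.Bundles using (CommutativeRing)
import Algebra.Properties.AbelianGroup as AbelianGroupProperties
import Algebra.Properties.CommutativeMonoid.Sum as CommutativeMonoidSum
import Algebra.Properties.Monoid.Mult as MonoidMult
import Algebra.Properties.Ring as RingProperties
open import Data.Bool.Base using (Bool; true; false; not)
open import Data.Empty using (⊥-elim)
open import Data.Fin.Base as Fin using (Fin; zero; suc; toℕ; inject₁)
open import Data.Fin.Properties as Finₚ using (toℕ-inject₁)
open import Data.Fin.Subset as Subset using (Subset; ∣_∣; inside; outside) renaming (⊥ to ∅)
open import Data.Fin.Subset.Properties as Subsetₚ using (_∈?_)
open import Data.List.Base as List using (List; []; _∷_; _++_; foldr; filter; allFin; length; concatMap)
open import Data.List.Properties using (foldr-++; length-++; length-map)
open import Data.List.Membership.Propositional renaming (_∈_ to _∈ˡ_)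
open import Data.List.Membership.Propositional.Properties using (∈-filter⁺; ∈-filter⁻; ∈-allFin)
open import Data.List.Relation.Unary.All as All using (All; []; _∷_)
open import Data.List.Relation.Unary.AllPairs using (AllPairs; []; _∷_)
open import Data.List.Relation.Unary.AllPairs.Properties using (filter⁺; tabulate⁺-<)
open import Data.List.Relation.Unary.Any using (here; there)
open import Data.Nat.Base using (ℕ; zero; suc; _+_; _≤_; z≤n; s≤s)
import Data.Nat.Properties as ℕₚ
open import Data.Product.Base using (∃; _×_; _,_; proj₁; proj₂)
open import Data.Sum.Base using (_⊎_; inj₁; inj₂)
open import Data.Vec.Base as Vec using (Vec; []; _∷_; lookup; _∷ʳ_; _[_]≔_; initLast)
open import Data.Vec.Properties using (lookup-replicate; lookup∘tabulate; lookup∘update′; []≔-updates; []≔-minimal; lookup⇒[]=; []=⇒lookup)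
open import Data.Vec.Functional using (Vector)
open import Function.Base using (id; _∘_)
open import Relation.Binary.PropositionalEquality as ≡ using (_≡_; _≢_; refl; cong; cong₂)
import Relation.Binary.Reasoning.Setoid as ≈-Reasoning
open import Relation.Nullary using (¬_; yes; no)

private
  variable
    n : ℕ

-- Generators acting on subsets, and the moment

swap : Fin n → Subset (suc n) → Subset (suc n)
swap zero    (a ∷ b ∷ v) = b ∷ a ∷ v
swap (suc i) (a ∷ v)     = a ∷ swap i v

-- A subset v stands for the vector ⟦ v ⟧ with entries -½ on v and ½ elsewhere.
act : Fin n → Subset n → Subset n
act zero    (b ∷ v) = not b ∷ v
act (suc i) v       = swap i v

run : List (Fin n) → Subset n → Subset n
run is v = foldr act v is

-- An element in position i is counted in the first i + 1 suffixes.
moment : Subset n → ℕ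
moment []      = 0
moment (b ∷ v) = ∣ b ∷ v ∣ + moment v

moment-∅ : ∀ n → moment (∅ {n}) ≡ 0
moment-∅ zero    = refl
moment-∅ (suc n) = cong₂ _+_ (Subsetₚ.∣⊥∣≡0 n) (moment-∅ n)

∣∷∣-cong : ∀ a (u v : Subset n) → ∣ u ∣ ≡ ∣ v ∣ → ∣ a ∷ u ∣ ≡ ∣ a ∷ v ∣
∣∷∣-cong true  _ _ = cong suc
∣∷∣-cong false _ _ = id

∣swap∣ : ∀ (i : Fin n) v → ∣ swap i v ∣ ≡ ∣ v ∣
∣swap∣ zero    (true  ∷ true  ∷ v) = refl
∣swap∣ zero    (true  ∷ false ∷ v) = refl
∣swap∣ zero    (false ∷ true  ∷ v) = refl
∣swap∣ zero    (false ∷ false ∷ v) = refl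
∣swap∣ (suc i) (a ∷ v)             = ∣∷∣-cong a (swap i v) v (∣swap∣ i v)

-- Only the suffix starting at `suc i` can change its size, and by at most one: earlier suffixes
-- contain both swapped positions, later ones neither.
moment-swap : ∀ (i : Fin n) v → moment (swap i v) ≤ suc (moment v)
moment-swap zero (true  ∷ true  ∷ v) = ℕₚ.n≤1+n _
moment-swap zero (true  ∷ false ∷ v) = s≤s (ℕₚ.≤-reflexive (ℕₚ.+-suc _ _))
moment-swap zero (false ∷ true  ∷ v) = s≤s (ℕₚ.≤-trans (ℕₚ.+-monoʳ-≤ ∣ v ∣ (ℕₚ.n≤1+n _)) (ℕₚ.n≤1+n _))
moment-swap zero (false ∷ false ∷ v) = ℕₚ.n≤1+n _
moment-swap (suc i) (a ∷ v) = begin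
  ∣ a ∷ swap i v ∣ + moment (swap i v) ≤⟨ ℕₚ.+-mono-≤ (ℕₚ.≤-reflexive (∣∷∣-cong a (swap i v) v (∣swap∣ i v))) (moment-swap i v) ⟩
  ∣ a ∷ v ∣ + suc (moment v)           ≡⟨ ℕₚ.+-suc _ _ ⟩
  suc (∣ a ∷ v ∣ + moment v)           ∎
  where open ℕₚ.≤-Reasoning

-- Position 0 lies in the full suffix only, so flipping it also changes the moment by one.
moment-act : ∀ (i : Fin n) v → moment (act i v) ≤ suc (moment v)
moment-act zero    (true  ∷ v) = ℕₚ.≤-trans (ℕₚ.n≤1+n _) (ℕₚ.n≤1+n _)
moment-act zero    (false ∷ v) = ℕₚ.≤-refl
moment-act (suc i) v           = moment-swap i v

moment-run : ∀ (is : List (Fin n)) v → moment (run is v) ≤ length is + moment v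
moment-run []       v = ℕₚ.≤-refl
moment-run (i ∷ is) v = ℕₚ.≤-trans (moment-act i (run is v)) (s≤s (moment-run is v))

∣insert∣ : ∀ (v : Subset n) j → lookup v j ≡ outside → ∣ v [ j ]≔ inside ∣ ≡ suc ∣ v ∣
∣insert∣ (false ∷ v) zero    _ = refl
∣insert∣ (true  ∷ v) (suc j) j∉v = cong suc (∣insert∣ v j j∉v)
∣insert∣ (false ∷ v) (suc j) j∉v = ∣insert∣ v j j∉v

-- Position `j` lies in exactly the `suc (toℕ j)` suffixes that start at or before it, and each of
-- them gains one element.
moment-insert : ∀ (v : Subset n) j → lookup v j ≡ outside →
                moment (v [ j ]≔ inside) ≡ suc (toℕ j) + moment v
moment-insert (false ∷ v) zero    _   = refl
moment-insert (b ∷ v)     (suc j) j∉v = begin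
  ∣ b ∷ (v [ j ]≔ inside) ∣ + moment (v [ j ]≔ inside)
    ≡⟨ cong₂ _+_ (∣∷insert∣ b) (moment-insert v j j∉v) ⟩
  suc ∣ b ∷ v ∣ + (suc (toℕ j) + moment v)
    ≡⟨ cong suc (x∙yz≈y∙xz ∣ b ∷ v ∣ (suc (toℕ j)) _) ⟩
  suc (suc (toℕ j)) + (∣ b ∷ v ∣ + moment v)
    ∎
  where
  open ≡.≡-Reasoning
  open import Algebra.Properties.CommutativeSemigroup ℕₚ.+-commutativeSemigroup using (x∙yz≈y∙xz)
  ∣∷insert∣ : ∀ b → ∣ b ∷ (v [ j ]≔ inside) ∣ ≡ suc ∣ b ∷ v ∣
  ∣∷insert∣ b = ∣insert∣ (b ∷ v) (suc j) j∉v

-- Splitting off the last coordinate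

swap-∷ʳ : ∀ (i : Fin n) v b → swap (inject₁ i) (v ∷ʳ b) ≡ swap i v ∷ʳ b
swap-∷ʳ zero    (x ∷ y ∷ v) b = refl
swap-∷ʳ (suc i) (x ∷ v)     b = cong (x ∷_) (swap-∷ʳ i v b)

act-∷ʳ : ∀ (i : Fin n) v b → act (inject₁ i) (v ∷ʳ b) ≡ act i v ∷ʳ b
act-∷ʳ zero    (x ∷ v) b = refl
act-∷ʳ (suc i) v       b = swap-∷ʳ i v b

-- The tail of `descending (suc j)` is `descending j` mapped by `inject₁`; since such letters never
-- touch the last coordinate, an induction on `j` can pass to one dimension less.
run-∷ʳ : ∀ (is : List (Fin n)) v b → run (List.map inject₁ is) (v ∷ʳ b) ≡ run is v ∷ʳ b
run-∷ʳ []       v b = refl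
run-∷ʳ (i ∷ is) v b = ≡.trans (cong (act (inject₁ i)) (run-∷ʳ is v b)) (act-∷ʳ i (run is v) b)

lookup-∷ʳ : ∀ {a} {A : Set a} (v : Vec A n) b i → lookup (v ∷ʳ b) (inject₁ i) ≡ lookup v i
lookup-∷ʳ (x ∷ v) b zero    = refl
lookup-∷ʳ (x ∷ v) b (suc i) = lookup-∷ʳ v b i

update-∷ʳ : ∀ {a} {A : Set a} (v : Vec A n) b i x →
            (v [ i ]≔ x) ∷ʳ b ≡ (v ∷ʳ b) [ inject₁ i ]≔ x
update-∷ʳ (_ ∷ v) b zero    x = refl
update-∷ʳ (y ∷ v) b (suc i) x = cong (y ∷_) (update-∷ʳ v b i x)

-- Both positions are empty in `v`, so the swap merely carries the inserted element one place up.
swap-insert : ∀ (i : Fin n) v → lookup v (inject₁ i) ≡ outside → lookup v (suc i) ≡ outside →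
              swap i (v [ inject₁ i ]≔ inside) ≡ v [ suc i ]≔ inside
swap-insert zero    (false ∷ false ∷ v) _ _ = refl
swap-insert (suc i) (b ∷ v)             p q = cong (b ∷_) (swap-insert i v p q)

-- Subsets and their sorted lists of elements

fromList : List (Fin n) → Subset n
fromList = foldr (λ j v → v [ j ]≔ inside) ∅

∉-fromList : ∀ {i : Fin n} {is} → All (i ≢_) is → lookup (fromList is) i ≡ outside
∉-fromList {i = i} []                      = lookup-replicate i outside
∉-fromList {i = i} {j ∷ is} (i≢j ∷ i≢is) =
  ≡.trans (lookup∘update′ i≢j (fromList is) inside) (∉-fromList i≢is)

∈-fromList⁺ : ∀ {i : Fin n} {is} → i ∈ˡ is → i Subset.∈ fromList is
∈-fromList⁺ {is = j ∷ is} (here refl)  = []≔-updates (fromList is) j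
∈-fromList⁺ {i = i} {j ∷ is} (there i∈is) with i Finₚ.≟ j
... | yes refl = []≔-updates (fromList is) j
... | no i≢j   = []≔-minimal (fromList is) i j i≢j (∈-fromList⁺ i∈is)

∈-fromList⁻ : ∀ {i : Fin n} is → i Subset.∈ fromList is → i ∈ˡ is
∈-fromList⁻ []       i∈∅ = ⊥-elim (Subsetₚ.∉⊥ i∈∅)
∈-fromList⁻ {i = i} (j ∷ is) i∈ with i Finₚ.≟ j
... | yes refl = here refl
... | no i≢j   = there (∈-fromList⁻ is (lookup⇒[]= i _
  (≡.trans (≡.sym (lookup∘update′ i≢j (fromList is) inside)) ([]=⇒lookup i∈))))

-- The list of indices over which `w[ J ]` multiplies the `wᵢ`.
elements : Subset n → List (Fin n)
elements {n} J = filter (_∈? J) (allFin n)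

fromList-elements : (J : Subset n) → fromList (elements J) ≡ J
fromList-elements {n} J = Subsetₚ.⊆-antisym
  (λ i∈ → proj₂ (∈-filter⁻ (_∈? J) {xs = allFin n} (∈-fromList⁻ (elements J) i∈)))
  (λ i∈J → ∈-fromList⁺ (∈-filter⁺ (_∈? J) (∈-allFin _) i∈J))

elements-sorted : (J : Subset n) → AllPairs Fin._<_ (elements J)
elements-sorted J = filter⁺ (_∈? J) (tabulate⁺-< id)

module _ {c ℓ₁ ℓ₂} (F : HeytingField c ℓ₁ ℓ₂) (char0 : CharacteristicZero F) where
  open TypeB F char0
  open HeytingField F hiding (zero; Carrier; _≈_; _+_; refl)
  open HeytingField F using () renaming (_+_ to _⊕_; refl to ≈-refl)
  open HeytingCommutativeRing heytingCommutativeRing using (commutativeRing)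
  open CommutativeRing commutativeRing using (ring; +-monoid; +-commutativeMonoid; +-abelianGroup)
  open HCRProperties heytingCommutativeRing using (x-0≈x; 1#0)
  open RingProperties ring using (-‿involutive; -‿distribˡ-*; -‿distribʳ-*)
  open AbelianGroupProperties +-abelianGroup using (⁻¹-anti-homo‿-; xyx⁻¹≈y)
  open MonoidMult +-monoid using (×-homo-+)
  open CommutativeMonoidSum +-commutativeMonoid using (∑-distrib-+; sum-cong-≋)

  -- The defining word of `w[ J ]`: its effect and its length

  word : Subset n → List (Fin n)
  word J = concatMap descending (elements J)

  length-descending : (j : Fin n) → length (descending j) ≡ suc (toℕ j)
  length-descending zero    = refl
  length-descending (suc j) =
    cong suc (≡.trans (length-map inject₁ (descending j)) (length-descending j))

  -- The rightmost letter, applied first, puts an element at the empty position 0, and the swaps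
  -- then carry it up through empty positions to `j`.
  run-descending : ∀ (j : Fin n) v → (∀ k → k Fin.≤ j → lookup v k ≡ outside) →
                   run (descending j) v ≡ v [ j ]≔ inside
  run-descending zero    (b ∷ v) below = cong (λ b → not b ∷ v) (below zero z≤n)
  -- All letters but the outermost act on the initial part `u` alone, where the induction hypothesis
  -- applies.
  run-descending (suc j) v       below with initLast v
  ... | u , b , refl = begin
    swap j (run (List.map inject₁ (descending j)) (u ∷ʳ b))
      ≡⟨ cong (swap j) (run-∷ʳ (descending j) u b) ⟩
    swap j (run (descending j) u ∷ʳ b)
      ≡⟨ cong (λ v → swap j (v ∷ʳ b)) (run-descending j u below′) ⟩
    swap j ((u [ j ]≔ inside) ∷ʳ b)
      ≡⟨ cong (swap j) (update-∷ʳ u b j inside) ⟩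
    swap j ((u ∷ʳ b) [ inject₁ j ]≔ inside)
      ≡⟨ swap-insert j (u ∷ʳ b) (below (inject₁ j) inject₁j≤) (below (suc j) ℕₚ.≤-refl) ⟩
    (u ∷ʳ b) [ suc j ]≔ inside
      ∎
    where
    open ≡.≡-Reasoning
    inject₁≤ : ∀ {k} → k Fin.≤ j → inject₁ k Fin.≤ suc j
    inject₁≤ {k} k≤j = ℕₚ.≤-trans (ℕₚ.≤-reflexive (toℕ-inject₁ k)) (ℕₚ.m≤n⇒m≤1+n k≤j)
    inject₁j≤ = inject₁≤ ℕₚ.≤-refl
    below′ : ∀ k → k Fin.≤ j → lookup u k ≡ outside
    below′ k k≤j = ≡.trans (≡.sym (lookup-∷ʳ u b k)) (below (inject₁ k) (inject₁≤ k≤j))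

  -- The largest index is processed first. When `j` has its turn, everything inserted so far lies
  -- above `j`, so the positions up to `j` are still empty.
  run-descendings : ∀ {is : List (Fin n)} → AllPairs Fin._<_ is →
                    run (concatMap descending is) ∅ ≡ fromList is
  run-descendings []                         = refl
  run-descendings {is = j ∷ is} (j<is ∷ is<) = begin
    run (descending j ++ concatMap descending is) ∅
      ≡⟨ foldr-++ act ∅ (descending j) (concatMap descending is) ⟩
    run (descending j) (run (concatMap descending is) ∅)
      ≡⟨ cong (run (descending j)) (run-descendings is<) ⟩
    run (descending j) (fromList is)
      ≡⟨ run-descending j (fromList is)
           (λ k k≤j → ∉-fromList (All.map (λ j<i → Finₚ.<⇒≢ (ℕₚ.≤-<-trans k≤j j<i)) j<is)) ⟩
    fromList (j ∷ is)
      ∎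
    where open ≡.≡-Reasoning

  -- Each block `descending j` has as many letters as inserting `j` adds to the moment.
  length-descendings : ∀ {is : List (Fin n)} → AllPairs Fin._<_ is →
                       length (concatMap descending is) ≡ moment (fromList is)
  length-descendings {n} []                       = ≡.sym (moment-∅ n)
  length-descendings {is = j ∷ is} (j<is ∷ is<) = begin
    length (descending j ++ concatMap descending is)
      ≡⟨ length-++ (descending j) ⟩
    length (descending j) + length (concatMap descending is)
      ≡⟨ cong₂ _+_ (length-descending j) (length-descendings is<) ⟩
    suc (toℕ j) + moment (fromList is)
      ≡⟨ moment-insert (fromList is) j (∉-fromList (All.map Finₚ.<⇒≢ j<is)) ⟨
    moment (fromList (j ∷ is))
      ∎
    where open ≡.≡-Reasoning

  run-word : (J : Subset n) → run (word J) ∅ ≡ J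
  run-word J = ≡.trans (run-descendings (elements-sorted J)) (fromList-elements J)

  length-word : (J : Subset n) → length (word J) ≡ moment J
  length-word J = ≡.trans (length-descendings (elements-sorted J)) (cong moment (fromList-elements J))

  -- Stated for values, since the corresponding elements of `W n` carry differently bracketed
  -- `Generated` proofs.
  product-++ : (xs ys : List (Fin n)) → ∀ v →
    product (List.map s (xs ++ ys)) ⟨$⟩ v ≡
    product (List.map s xs) ⟨$⟩ (product (List.map s ys) ⟨$⟩ v)
  product-++ []       ys v = refl
  product-++ (x ∷ xs) ys v = cong (reflection x) (product-++ xs ys v)

  product-concatMap : (js : List (Fin n)) → ∀ v →
    product (List.map s (concatMap descending js)) ⟨$⟩ v ≡ product (List.map wᵢ js) ⟨$⟩ v
  product-concatMap []       v = refl
  product-concatMap (j ∷ js) v = ≡.trans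
    (product-++ (descending j) (concatMap descending js) v)
    (cong (wᵢ j ⟨$⟩_) (product-concatMap js v))

  product-word : (J : Subset n) → product (List.map s (word J)) ≈ʷ w[ J ]
  product-word J v i = reflexive (cong (λ u → u i) (product-concatMap (elements J) v))

  -- Scalars and sign vectors

  inverse-inverseˡ : ∀ x x#0 → inverse x x#0 * x ≈ 1#
  inverse-inverseˡ x x#0 =
    trans (*-congˡ (sym (x-0≈x x))) (proj₁ (proj₂ (#⇒invertible x#0)))

  2x≈x+x : ∀ x → 2# * x ≈ x ⊕ x
  2x≈x+x x = trans (distribʳ x 1# (1# ⊕ 0#))
    (+-cong (*-identityˡ x) (trans (*-congʳ (+-identityʳ 1#)) (*-identityˡ x)))

  x-[x-y]≈y : ∀ x y → x - (x - y) ≈ y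
  x-[x-y]≈y x y = trans (+-congˡ (⁻¹-anti-homo‿- x y)) (trans (sym (+-assoc x y (- x))) (xyx⁻¹≈y x y))

  ½-½≈0 : ½ - ½ ≈ 0#
  ½-½≈0 = -‿inverseʳ ½

  ½+½≈1 : ½ - - ½ ≈ 1#
  ½+½≈1 = trans (+-congˡ (-‿involutive ½))
    (trans (sym (2x≈x+x ½)) (trans (*-comm 2# ½) (inverse-inverseˡ 2# (char0 1))))

  signed : Bool → Carrier
  signed true  = - ½
  signed false = ½

  indicator : Bool → Carrier
  indicator true  = 1#
  indicator false = 0#

  ⟦_⟧ : Subset n → Vector Carrier n
  ⟦ v ⟧ i = signed (lookup v i)

  signed-not : ∀ b → - signed b ≈ signed (not b)
  signed-not true  = -‿involutive ½
  signed-not false = ≈-refl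

  ½-signed : ∀ b → ½ - signed b ≈ indicator b
  ½-signed true  = ½+½≈1
  ½-signed false = ½-½≈0

  indicator-binary : ∀ b {a} → a ≈ indicator b → a ≈ 0# ⊎ a ≈ 1#
  indicator-binary true  = inj₂
  indicator-binary false = inj₁

  1≉0 : ¬ (1# ≈ 0#)
  1≉0 1≈0 = #-irrefl 1≈0 1#0

  indicator-injective : ∀ a b → indicator a ≈ indicator b → a ≡ b
  indicator-injective true  true  _   = refl
  indicator-injective true  false 1≈0 = ⊥-elim (1≉0 1≈0)
  indicator-injective false true  0≈1 = ⊥-elim (1≉0 (sym 0≈1))
  indicator-injective false false _   = refl

  -- Passing to `½ - signed b` reduces the claim to `1#` and `0#` being distinct.
  signed-injective : ∀ a b → signed a ≈ signed b → a ≡ b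
  signed-injective a b eq = indicator-injective a b
    (trans (sym (½-signed a)) (trans (+-congˡ (-‿cong eq)) (½-signed b)))

  ⟦⟧-injective : (u v : Subset n) → ⟦ u ⟧ ≈ᵛ ⟦ v ⟧ → u ≡ v
  ⟦⟧-injective []      []      _  = refl
  ⟦⟧-injective (a ∷ u) (b ∷ v) eq =
    cong₂ _∷_ (signed-injective a b (eq zero)) (⟦⟧-injective u v (eq ∘ suc))

  λB≈⟦∅⟧ : λB {n} ≈ᵛ ⟦ ∅ ⟧
  λB≈⟦∅⟧ i = reflexive (cong signed (≡.sym (lookup-replicate i outside)))

  -- Reflections on sign vectors

  x-y[0-0]≈x : ∀ x y → x - y * (0# - 0#) ≈ x
  x-y[0-0]≈x x y = trans (+-congˡ (-‿cong (trans (*-congˡ 0-0≈0) (zeroʳ y)))) (x-0≈x x)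

  ⟨α-zero,⟩ : (u : Vector Carrier (suc n)) → ⟨ α zero , u ⟩ ≈ u zero
  ⟨α-zero,⟩ u = trans
    (+-cong (*-identityˡ _) (sum-0 (λ i → 0# * u (suc i)) (λ i → zeroˡ (u (suc i)))))
    (+-identityʳ _)

  -- The induction strips the first coordinate: `α (suc (suc i))` starts with `0# - 0#`, and its
  -- tail is definitionally `α (suc i)`.
  ⟨α-suc,⟩ : (i : Fin n) (u : Vector Carrier (suc n)) →
             ⟨ α (suc i) , u ⟩ ≈ u (suc i) - u (inject₁ i)
  ⟨α-suc,⟩ zero u = begin
    (0# - 1#) * u zero ⊕ ((1# - 0#) * u (suc zero) ⊕ sum (λ k → (0# - 0#) * u (suc (suc k))))
      ≈⟨ +-cong (trans (*-congʳ (+-identityˡ _)) (trans (sym (-‿distribˡ-* _ _)) (-‿cong (*-identityˡ _))))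
                (+-cong (trans (*-congʳ 1-0≈1) (*-identityˡ _))
                        (sum-0 (λ k → (0# - 0#) * u (suc (suc k)))
                               (λ _ → trans (*-congʳ 0-0≈0) (zeroˡ _)))) ⟩
    - u zero ⊕ (u (suc zero) ⊕ 0#)
      ≈⟨ +-congˡ (+-identityʳ _) ⟩
    - u zero ⊕ u (suc zero)
      ≈⟨ +-comm _ _ ⟩
    u (suc zero) - u zero
      ∎
    where open ≈-Reasoning setoid
  ⟨α-suc,⟩ (suc i) u = trans
    (+-cong (trans (*-congʳ 0-0≈0) (zeroˡ _)) (⟨α-suc,⟩ i (u ∘ suc)))
    (+-identityˡ _)

  reflection-cong : ∀ (i : Fin n) {u v} → u ≈ᵛ v → reflection i u ≈ᵛ reflection i v
  reflection-cong i u≈v k = +-cong (u≈v k)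
    (-‿cong (*-congʳ (*-congˡ (*-congʳ (sum-cong-≋ (λ j → *-congˡ (u≈v j)))))))

  -- The short root has norm 1, so the factor `2#` survives and doubles the entry.
  coefficient-zero : (u : Vector Carrier (suc n)) →
    2# * (⟨ α zero , u ⟩ * inverse _ (norm-α#0 (zero {n}))) ≈ u zero ⊕ u zero
  coefficient-zero {n} u = trans
    (*-congˡ (trans (*-cong (⟨α-zero,⟩ u) inverse≈1) (*-identityʳ _)))
    (2x≈x+x _)
    where
    inverse≈1 : inverse _ (norm-α#0 (zero {n})) ≈ 1#
    inverse≈1 = trans (sym (*-identityʳ _))
      (trans (*-congˡ (sym (norm-zero {n}))) (inverse-inverseˡ _ (norm-α#0 (zero {n}))))

  -- A long root has norm 2, which cancels the factor `2#`.
  coefficient-suc : (i : Fin n) (u : Vector Carrier (suc n)) →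
    2# * (⟨ α (suc i) , u ⟩ * inverse ⟨ α (suc i) , α (suc i) ⟩ (norm-α#0 (suc i))) ≈
    u (suc i) - u (inject₁ i)
  coefficient-suc i u = begin
    2# * (⟨ α (suc i) , u ⟩ * norm⁻¹)     ≈⟨ *-comm _ _ ⟩
    ⟨ α (suc i) , u ⟩ * norm⁻¹ * 2#       ≈⟨ *-assoc _ _ _ ⟩
    ⟨ α (suc i) , u ⟩ * (norm⁻¹ * 2#)     ≈⟨ *-congˡ (*-congˡ (norm-suc i)) ⟨
    ⟨ α (suc i) , u ⟩ * (norm⁻¹ * ⟨ α (suc i) , α (suc i) ⟩)
      ≈⟨ *-congˡ (inverse-inverseˡ _ (norm-α#0 (suc i))) ⟩
    ⟨ α (suc i) , u ⟩ * 1#                ≈⟨ *-identityʳ _ ⟩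
    ⟨ α (suc i) , u ⟩                     ≈⟨ ⟨α-suc,⟩ i u ⟩
    u (suc i) - u (inject₁ i)             ∎
    where
    open ≈-Reasoning setoid
    norm⁻¹ : Carrier
    norm⁻¹ = inverse ⟨ α (suc i) , α (suc i) ⟩ (norm-α#0 (suc i))

  -- The left side is the reflection with its coefficient already simplified; in this form the
  -- induction on `i` can strip the first coordinate.
  ⟦swap⟧ : ∀ (i : Fin n) v k →
           ⟦ v ⟧ k - (⟦ v ⟧ (suc i) - ⟦ v ⟧ (inject₁ i)) * α (suc i) k ≈ ⟦ swap i v ⟧ k
  ⟦swap⟧ zero (a ∷ b ∷ v) zero = begin
    signed a - d * (0# - 1#)         ≈⟨ +-congˡ (-‿cong (*-congˡ (+-identityˡ _))) ⟩
    signed a - d * - 1#              ≈⟨ +-congˡ (-‿cong (trans (sym (-‿distribʳ-* d 1#)) (-‿cong (*-identityʳ d)))) ⟩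
    signed a - - d                   ≈⟨ +-congˡ (-‿cong (⁻¹-anti-homo‿- (signed b) (signed a))) ⟩
    signed a - (signed a - signed b) ≈⟨ x-[x-y]≈y _ _ ⟩
    signed b                         ∎
    where
    open ≈-Reasoning setoid
    d = signed b - signed a
  ⟦swap⟧ zero (a ∷ b ∷ v) (suc zero) =
    trans (+-congˡ (-‿cong (trans (*-congˡ 1-0≈1) (*-identityʳ _)))) (x-[x-y]≈y _ _)
  ⟦swap⟧ zero    (a ∷ b ∷ v) (suc (suc k)) = x-y[0-0]≈x _ _
  ⟦swap⟧ (suc i) (a ∷ v)     zero          = x-y[0-0]≈x _ _
  ⟦swap⟧ (suc i) (a ∷ v)     (suc k)       = ⟦swap⟧ i v k

  reflection-⟦⟧ : ∀ (i : Fin n) v → reflection i ⟦ v ⟧ ≈ᵛ ⟦ act i v ⟧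
  reflection-⟦⟧ {suc n} zero (b ∷ v) zero = begin
    reflection zero ⟦ b ∷ v ⟧ zero
      ≈⟨ +-congˡ (-‿cong (trans (*-identityʳ _) (coefficient-zero {n} ⟦ b ∷ v ⟧))) ⟩
    signed b - (signed b ⊕ signed b)
      -- The double is rewritten as a difference `signed b - y` with `y = - signed b`, to match
      -- `x-[x-y]≈y`.
      ≈⟨ +-congˡ (-‿cong (+-congˡ (-‿involutive _))) ⟨
    signed b - (signed b - - signed b)
      ≈⟨ x-[x-y]≈y _ _ ⟩
    - signed b
      ≈⟨ signed-not b ⟩
    signed (not b)
      ∎
    where open ≈-Reasoning setoid
  reflection-⟦⟧ zero (b ∷ v) (suc k) =
    trans (+-congˡ (-‿cong (zeroʳ _))) (x-0≈x _)
  reflection-⟦⟧ (suc i) v k =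
    trans (+-congˡ (-‿cong (*-congʳ (coefficient-suc i ⟦ v ⟧)))) (⟦swap⟧ i v k)

  -- The start vector is taken up to `≈ᵛ` so that `λB` can stand in for `⟦ ∅ ⟧`.
  product-⟦⟧ : ∀ (is : List (Fin n)) {u v} → u ≈ᵛ ⟦ v ⟧ → product (List.map s is) ⟨$⟩ u ≈ᵛ ⟦ run is v ⟧
  product-⟦⟧ []       u≈v   = u≈v
  product-⟦⟧ (i ∷ is) {v = v} u≈v k =
    trans (reflection-cong i (product-⟦⟧ is u≈v) k) (reflection-⟦⟧ i (run is v) k)

  -- The length of `w[ J ]`

  w[]-λB : (J : Subset n) → w[ J ] ⟨$⟩ λB ≈ᵛ ⟦ J ⟧
  w[]-λB J i = trans (sym (product-word J λB i))
    (trans (product-⟦⟧ (word J) λB≈⟦∅⟧ i) (reflexive (cong (λ K → ⟦ K ⟧ i) (run-word J))))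

  -- Phrased up to `≈ʷ` to serve both arbitrary elements of `𝓜` and `w[ supp x x∈01 ]` itself.
  hasLength : {w : W n} (J : Subset n) → w ≈ʷ w[ J ] → HasLength w (moment J)
  hasLength {n} {w} J w≈ = record
    { attained = word J , length-word J , λ v i → trans (product-word J v i) (sym (w≈ v i))
    ; least    = least
    }
    where
    open ℕₚ.≤-Reasoning
    least : ∀ is → product (List.map s is) ≈ʷ w → moment J ≤ length is
    least is is≈w = begin
      moment J                        ≡⟨ cong moment (⟦⟧-injective (run is ∅) J run≈J) ⟨
      moment (run is ∅)               ≤⟨ moment-run is ∅ ⟩
      length is + moment (∅ {n})      ≡⟨ cong (length is +_) (moment-∅ n) ⟩
      length is + 0                   ≡⟨ ℕₚ.+-identityʳ _ ⟩
      length is                       ∎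
      where
      -- Any word for `w` sends `λB` where `w[ J ]` does; as sign vectors determine their subsets,
      -- it must carry `∅` to `J`.
      run≈J : ⟦ run is ∅ ⟧ ≈ᵛ ⟦ J ⟧
      run≈J i = trans (sym (product-⟦⟧ is λB≈⟦∅⟧ i))
        (trans (is≈w λB i) (trans (w≈ λB i) (w[]-λB J i)))

  -- The moment function on binary vectors

  sum-indicator : ∀ (v : Subset n) {x} → (∀ i → x i ≈ indicator (lookup v i)) → sum x ≈ fromℕ ∣ v ∣
  sum-indicator []          x≈ = ≈-refl
  sum-indicator (true  ∷ v) x≈ = +-cong (x≈ zero) (sum-indicator v (x≈ ∘ suc))
  sum-indicator (false ∷ v) x≈ = trans (+-cong (x≈ zero) (sum-indicator v (x≈ ∘ suc))) (+-identityˡ _)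

  -- Taking one off every weight splits `ρ x` into `sum x` plus `ρ` of the tail, which is the
  -- recursion of `moment`.
  ρ-indicator : ∀ (v : Subset n) {x} → (∀ i → x i ≈ indicator (lookup v i)) → ρ x ≈ fromℕ (moment v)
  ρ-indicator []          x≈ = ≈-refl
  ρ-indicator (b ∷ v) {x} x≈ = begin
    (x zero ⊕ 0#) ⊕ sum (λ i → x (suc i) ⊕ suc (toℕ i) · x (suc i))
      ≈⟨ +-cong (+-identityʳ _) (∑-distrib-+ (x ∘ suc) (λ i → suc (toℕ i) · x (suc i))) ⟩
    x zero ⊕ (sum (x ∘ suc) ⊕ ρ (x ∘ suc))
      ≈⟨ +-assoc _ _ _ ⟨
    sum x ⊕ ρ (x ∘ suc)
      ≈⟨ +-cong (sum-indicator (b ∷ v) x≈) (ρ-indicator v (x≈ ∘ suc)) ⟩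
    fromℕ ∣ b ∷ v ∣ ⊕ fromℕ (moment v)
      ≈⟨ ×-homo-+ 1# ∣ b ∷ v ∣ (moment v) ⟨
    fromℕ (moment (b ∷ v))
      ∎
    where open ≈-Reasoning setoid

  𝐱-indicator : {w : W n} (J : Subset n) → w ≈ʷ w[ J ] → ∀ i → 𝐱 w i ≈ indicator (lookup J i)
  𝐱-indicator J w≈ i = trans
    (+-congˡ (-‿cong (trans (w≈ λB i) (w[]-λB J i)))) (½-signed (lookup J i))

  supp-indicator : (x : Vector Carrier n) (x∈01 : Binary x) →
                   ∀ i → x i ≈ indicator (lookup (supp x x∈01) i)
  supp-indicator x x∈01 i = trans (isOne-indicator (x∈01 i))
    (reflexive (cong indicator (≡.sym (lookup∘tabulate (λ i → isOne (x∈01 i)) i))))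
    where
    isOne-indicator : ∀ {a} (d : a ≈ 0# ⊎ a ≈ 1#) → a ≈ indicator (isOne d)
    isOne-indicator (inj₁ a≈0) = a≈0
    isOne-indicator (inj₂ a≈1) = a≈1

theorem3p4 : ∀ {c ℓ₁ ℓ₂} (F : HeytingField c ℓ₁ ℓ₂) (char0 : CharacteristicZero F)
    (n : ℕ) → 2 ≤ n →
    let open TypeB F char0
    in ((w : W n) → 𝓜 w →
    Binary (𝐱 w) × (∃ λ r → HasLength w r × fromℕ r ≈ ρ (𝐱 w)))
    ×
    ((x : Vector Carrier n) (x∈01 : Binary x) →
    ∃ λ r → HasLength w[ supp x x∈01 ] r × ρ x ≈ fromℕ r)
theorem3p4 F char0 n _ =
  (λ w (J , w≈) →
    (λ i → indicator-binary F char0 (lookup J i) (𝐱-indicator F char0 {w = w} J w≈ i)) ,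
    moment J , hasLength F char0 J w≈ ,
    sym (ρ-indicator F char0 J (𝐱-indicator F char0 {w = w} J w≈))) ,
  (λ x x∈01 → let J = supp x x∈01 in
    moment J , hasLength F char0 J (λ _ _ → ≈-refl) ,
    ρ-indicator F char0 J (supp-indicator F char0 x x∈01))
  where
  open TypeB F char0 using (supp)
  open HeytingField F using (sym) renaming (refl to ≈-refl)
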